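{- Let $q$ be a prime power and let $n\geq 2$ be an integer. The number of distance vectors in $\mathcal{D}(n)$, the set of distance vectors for the full flag variety on $\mathbb{F}_q^n$, is the $n$-th Motzkin number $M_n$.
   Context: Let $\mathbb{F}_q$ be the finite field with $q$ elements. A full flag on $\mathbb{F}_q^n$ is a sequence $\mathcal{F}=(\mathcal{F}_1,\dots,\mathcal{F}_{n-1})$ of $\mathbb{F}_q$-subspaces of $\mathbb{F}_q^n$ with $\mathcal{F}_1\subsetneq\cdots\subsetneq\mathcal{F}_{n-1}$ and $\dim \mathcal{F}_i=i$ for every $i$; the set of all full flags is the full flag variety $\mathcal{F}_q(n)$. For subspaces $\mathcal{U},\mathcal{V}$ of the same dimension $k$, the injection distance is $d_I(\mathcal{U},\mathcal{V})=k-\dim(\mathcal{U}\cap\mathcal{V})$. The distance vector of $\mathcal{F},\mathcal{F}'\in\mathcal{F}_q(n)$ is $\mathbf{d}(\mathcal{F},\mathcal{F}')=(d_I(\mathcal{F}_1,\mathcal{F}'_1),\dots,d_I(\mathcal{F}_{n-1},\mathcal{F}'_{n-1}))\in\mathbb{Z}^{n-1}$, and $\mathcal{D}(n)=\{\mathbf{d}(\mathcal{F},\mathcal{F}') \mid \mathcal{F},\mathcal{F}'\in\mathcal{F}_q(n)\}$ (pairs with $\mathcal{F}=\mathcal{F}'$ are allowed, so the zero vector belongs to $\mathcal{D}(n)$). The Motzkin numbers are given by $M_0=1$ and $M_n=M_{n-1}+\sum_{k=0}^{n-2}M_kM_{n-k-2}$ for $n\geq 1$ (the sum being empty for $n=1$).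 It is well known that $M_n$ is the number of Motzkin paths of length $n$, i.e. lattice paths from $(0,0)$ to $(n,0)$ with steps $(1,1)$, $(1,-1)$, $(1,0)$ that never run below the $x$-axis. -}

module Defs where

open import Level using (Level; _⊔_) renaming (suc to lsuc)
open import Algebra.Apartness.Bundles using (HeytingField; HeytingCommutativeRing)
open import Algebra.Bundles using (CommutativeRing)
import Algebra.Properties.Monoid.Sum as MonoidSum
open import Data.Fin.Base as Fin using (Fin; toℕ; opposite)
open import Data.Fin.Properties using (toℕ<n)
open import Data.Integer.Base as ℤ using (ℤ; +_)
open import Data.List.Base using (length)
open import Data.List.Membership.Propositional using (_∈_)
open import Data.List.Relation.Unary.Unique.Propositional using (Unique)
open import Data.Nat.Base using (ℕ; zero; suc; _+_; _*_; _∸_; _^_; _≤_; _<_)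
open import Data.Nat.Induction using (<-wellFounded; Acc; acc)
open import Data.Nat.Primality using (Prime)
open import Data.Nat.Properties using (+-0-monoid; n<1+n; m≤n⇒m≤1+n)
open import Data.Product.Base using (∃-syntax; _×_; _,_)
open import Data.Vec.Base using (Vec; lookup)
open import Data.Vec.Functional using (Vector)
import Data.Vec.Functional.Relation.Binary.Equality.Setoid as VectorEquality
open import Function.Bundles using (Inverse; _⇔_)
open import Relation.Binary.PropositionalEquality
  using (_≡_; refl; cong; cong₂; setoid)
open import Relation.Unary using (Pred; _∩_; _⊂_)

------------------------------------------------------------------------
-- Motzkin numbers

open MonoidSum +-0-monoid using () renaming (sum to sumℕ; sum-cong-≗ to sumℕ-cong)

-- For k : Fin n, toℕ k runs over 0, …, n - 1 and toℕ (opposite k) is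
-- n - 1 - toℕ k; the recurrence is spelled out in motzkin-suc below.
motzkinAcc : ∀ n → Acc _<_ n → ℕ
motzkinAcc zero    _        = 1
motzkinAcc (suc n) (acc rs) =
  motzkinAcc n (rs (n<1+n n)) +
  sumℕ {n} (λ k → motzkinAcc (toℕ k) (rs (m≤n⇒m≤1+n (toℕ<n k))) *
                  motzkinAcc (toℕ (opposite k)) (rs (m≤n⇒m≤1+n (toℕ<n (opposite k)))))

motzkin : ℕ → ℕ
motzkin n = motzkinAcc n (<-wellFounded n)

motzkinAcc-irrelevant : ∀ n (a b : Acc _<_ n) → motzkinAcc n a ≡ motzkinAcc n b
motzkinAcc-irrelevant zero    _        _        = refl
motzkinAcc-irrelevant (suc n) (acc rs) (acc ss) = cong₂ _+_
  (motzkinAcc-irrelevant n _ _)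
  (sumℕ-cong {n} λ k → cong₂ _*_
    (motzkinAcc-irrelevant (toℕ k) (rs (m≤n⇒m≤1+n (toℕ<n k))) (ss (m≤n⇒m≤1+n (toℕ<n k))))
    (motzkinAcc-irrelevant (toℕ (opposite k))
      (rs (m≤n⇒m≤1+n (toℕ<n (opposite k)))) (ss (m≤n⇒m≤1+n (toℕ<n (opposite k))))))

motzkin-zero : motzkin 0 ≡ 1
motzkin-zero = refl

motzkin-suc : ∀ n → motzkin (suc n) ≡
  motzkin n + sumℕ {n} (λ k → motzkin (toℕ k) * motzkin (toℕ (opposite k)))
motzkin-suc n = go (<-wellFounded (suc n))
  where
  go : (a : Acc _<_ (suc n)) → motzkinAcc (suc n) a ≡
       motzkin n + sumℕ {n} (λ k → motzkin (toℕ k) * motzkin (toℕ (opposite k)))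
  go (acc rs) = cong₂ _+_
    (motzkinAcc-irrelevant n _ _)
    (sumℕ-cong {n} λ k → cong₂ _*_
      (motzkinAcc-irrelevant (toℕ k) (rs (m≤n⇒m≤1+n (toℕ<n k))) (<-wellFounded (toℕ k)))
      (motzkinAcc-irrelevant (toℕ (opposite k))
        (rs (m≤n⇒m≤1+n (toℕ<n (opposite k)))) (<-wellFounded (toℕ (opposite k)))))

------------------------------------------------------------------------
-- Prime powers and cardinalities

IsPrimePower : ℕ → Set
IsPrimePower q = ∃[ p ] ∃[ k ] Prime p × 1 ≤ k × q ≡ p ^ k

-- The subset P of A has exactly m elements.
HasCardinality : ∀ {a p : Level} {A : Set a} → Pred A p → ℕ → Set (a ⊔ p)
HasCardinality {A = A} P m =
  ∃[ xs ] Unique {A = A} xs × length xs ≡ m × (∀ x → x ∈ xs ⇔ P x)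

------------------------------------------------------------------------
-- Flags
--
-- When the carrier is finite, equality is decidable and the apartness
-- of a Heyting field is forced to be inequality, so the F of order q are
-- exactly the fields with q elements.

module _ {c ℓ₁ ℓ₂ : Level} (F : HeytingField c ℓ₁ ℓ₂) where

  private
    module H = HeytingField F

  commutativeRing : CommutativeRing c ℓ₁
  commutativeRing = HeytingCommutativeRing.commutativeRing H.heytingCommutativeRing

  private
    module R = CommutativeRing commutativeRing

  open MonoidSum R.+-monoid using (sum)
  open VectorEquality R.setoid using (_≋_)

  HasOrder : ℕ → Set (c ⊔ ℓ₁)
  HasOrder q = Inverse R.setoid (setoid (Fin q))

  linearCombination : ∀ {n k} → Vector R.Carrier k →
                      Vector (Vector R.Carrier n) k → Vector R.Carrier n
  linearCombination a b j = sum (λ i → a i R.* b i j)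

  record Subspace (n : ℕ) : Set (lsuc (c ⊔ ℓ₁)) where
    field
      member   : Pred (Vector R.Carrier n) (c ⊔ ℓ₁)
      resp-≋   : ∀ {u v} → u ≋ v → member u → member v
      0-closed : member (λ _ → R.0#)
      +-closed : ∀ {u v} → member u → member v → member (λ j → u j R.+ v j)
      *-closed : ∀ a {v} → member v → member (λ j → a R.* v j)

  open Subspace

  infixr 7 _⊓_

  _⊓_ : ∀ {n} → Subspace n → Subspace n → Subspace n
  U ⊓ V = record
    { member   = member U ∩ member V
    ; resp-≋   = λ u≋v (p , q) → resp-≋ U u≋v p , resp-≋ V u≋v q
    ; 0-closed = 0-closed U , 0-closed V
    ; +-closed = λ (p , q) (r , s) → +-closed U p r , +-closed V q s
    ; *-closed = λ a (p , q) → *-closed U a p , *-closed V a q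
    }

  record IsBasis {n k : ℕ} (U : Subspace n) (b : Vector (Vector R.Carrier n) k)
                 : Set (c ⊔ ℓ₁) where
    field
      inside      : ∀ i → member U (b i)
      independent : ∀ a → linearCombination a b ≋ (λ _ → R.0#) → ∀ i → a i R.≈ R.0#
      spanning    : ∀ v → member U v → ∃[ a ] v ≋ linearCombination a b

  -- Dimension is a relation, since an arbitrary membership predicate has no
  -- computable dimension; the k with HasDim U k is unique.
  HasDim : ∀ {n} → Subspace n → ℕ → Set (c ⊔ ℓ₁)
  HasDim U k = ∃[ b ] IsBasis {k = k} U b

  -- The index i : Fin (n ∸ 1) stands for the subspace of dimension toℕ i + 1.
  record FullFlag (n : ℕ) : Set (lsuc (c ⊔ ℓ₁)) where
    field
      space  : Fin (n ∸ 1) → Subspace n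
      strict : ∀ {i j} → i Fin.< j → member (space i) ⊂ member (space j)
      dim    : ∀ i → HasDim (space i) (suc (toℕ i))

  open FullFlag

  IsInjectionDistance : ∀ {n} → Subspace n → Subspace n → ℤ → Set (c ⊔ ℓ₁)
  IsInjectionDistance U V d =
    ∃[ k ] ∃[ m ] HasDim U k × HasDim V k × HasDim (U ⊓ V) m × d ≡ + k ℤ.- + m

  IsDistanceVector : ∀ {n} → FullFlag n → FullFlag n → Vec ℤ (n ∸ 1) → Set (c ⊔ ℓ₁)
  IsDistanceVector 𝓕 𝓖 d =
    ∀ i → IsInjectionDistance (space 𝓕 i) (space 𝓖 i) (lookup d i)

  DistanceVectors : ∀ n → Pred (Vec ℤ (n ∸ 1)) (lsuc (c ⊔ ℓ₁))
  DistanceVectors n d = ∃[ 𝓕 ] ∃[ 𝓖 ] IsDistanceVector {n} 𝓕 𝓖 d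

-- The distance vectors are exactly the sequences of inner heights of the
-- Motzkin-step paths of length n.
--
-- A distance vector is such a sequence: passing from 𝓕ᵢ ∩ 𝓖ᵢ to
-- 𝓕ᵢ₊₁ ∩ 𝓖ᵢ₊₁ raises the dimension by 0, 1 or 2. The upper bound is an
-- inequality between dimensions that follows by counting points over a finite
-- field, so no choice of complements is needed.
--
-- Conversely, heights hᵢ are realised by two coordinate flags: their i-th
-- spaces are spanned by the eⱼ with j < i - hᵢ together with the eⱼ with j even
-- (resp. odd) in the window i - hᵢ ≤ j < i + hᵢ. Both ends of the window are
-- monotone in i because h is 1-Lipschitz, which makes the spaces nested; the
-- window has even length, so each of the two spaces has dimension i, and their
-- intersection is spanned by the eⱼ with j < i - hᵢ.

module Submission where

open import Defs
open import Level using (Level; _⊔_; Lift; lift; lower)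
open import Algebra.Apartness.Bundles using (HeytingField)
open import Algebra.Bundles using (CommutativeRing)
import Algebra.Properties.CommutativeMonoid.Sum as CommutativeMonoidSum
import Algebra.Properties.Ring as RingProperties
open import Data.Bool.Base using (Bool; true; false; _∧_; _∨_; not)
open import Data.Bool.Properties using (∧-zeroʳ)
open import Data.Fin.Base as Fin using
  (Fin; zero; suc; toℕ; opposite; combine; remQuot; funToFin; finToFun)
open import Data.Fin.Properties using
  (_≟_; any?; combine-injective; combine-remQuot; funToFin-finToFin; finToFun-funToFin;
   injective⇒≤; toℕ<n; toℕ-fromℕ; toℕ-inject₁)
open import Data.Integer.Base as ℤ using (ℤ; ∣_∣) renaming (+_ to pos)
import Data.Integer.Properties as ℤ
open import Data.List.Base using (List; []; _∷_; _++_; map; length)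
open import Data.List.Properties using (length-++; length-map)
open import Data.List.Membership.Propositional using (_∈_)
open import Data.List.Membership.Propositional.Properties using
  (∈-++⁺ˡ; ∈-++⁺ʳ; ∈-++⁻; ∈-map⁺; ∈-map⁻)
open import Data.List.Relation.Unary.All using ([])
open import Data.List.Relation.Unary.AllPairs using ([]; _∷_)
open import Data.List.Relation.Unary.Any using (here)
open import Data.List.Relation.Unary.Unique.Propositional using (Unique)
import Data.List.Relation.Unary.Unique.Propositional.Properties as Unique
open import Data.Nat.Base using
  (ℕ; zero; suc; _+_; _*_; _∸_; _^_; _≤_; _<_; _<ᵇ_; z≤n; s≤s; nonTrivial⇒nonZero; nonTrivial⇒n>1)
open import Data.Nat.Induction using (<-rec)
open import Data.Nat.Primality using (prime)
import Data.Nat.Properties as ℕ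
open import Data.Nat.Tactic.RingSolver using (solve-∀)
open import Data.Product.Base using (∃-syntax; _×_; _,_; proj₁; proj₂)
open import Data.Sum.Base using (_⊎_; inj₁; inj₂; [_,_]′)
open import Data.Vec.Base as Vec using (Vec; []; _∷_; lookup)
open import Data.Vec.Functional as V using (Vector)
import Data.Vec.Functional.Relation.Binary.Equality.Setoid as VectorEquality
open import Data.Vec.Properties using (∷-injectiveʳ)
open import Function.Base using (_∘_; id)
open import Function.Bundles using (Inverse; mk⇔)
import Relation.Binary.Reasoning.Setoid as SetoidReasoning
open import Relation.Binary.PropositionalEquality as ≡ using (_≡_; refl; _≗_)
open import Relation.Nullary using (¬_; yes; no; contradiction; contradiction-irr)
open import Relation.Unary using (_⊆_)

open CommutativeMonoidSum ℕ.+-0-commutativeMonoid using () renaming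
  (sum to sumℕ; sum-cong-≗ to sumℕ-cong; ∑-distrib-+ to sumℕ-distrib-+)

-- Counting Motzkin paths by convolution

convolution : (ℕ → ℕ) → (ℕ → ℕ) → ℕ → ℕ
convolution f g n = sumℕ {n} λ k → f (toℕ k) * g (toℕ (opposite k))

-- The arguments of f and g add up to n - 1 in `convolution f g n`, so at `suc n` the term k = 0
-- pairs `f 0` with `g n` and the other terms shift f by one.
convolution-suc : ∀ f g n →
  convolution f g (suc n) ≡ f 0 * g n + convolution (f ∘ suc) g n
convolution-suc f g n = ≡.cong₂ _+_
  (≡.cong (λ m → f 0 * g m) (toℕ-fromℕ n))
  (sumℕ-cong {n} λ k → ≡.cong (λ m → f (suc (toℕ k)) * g m) (toℕ-inject₁ (opposite k)))

convolution-distribʳ-+ : ∀ f f′ g n →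
  convolution (λ k → f k + f′ k) g n ≡ convolution f g n + convolution f′ g n
convolution-distribʳ-+ f f′ g n = ≡.trans
  (sumℕ-cong {n} λ k → ℕ.*-distribʳ-+ (g (toℕ (opposite k))) (f (toℕ k)) (f′ (toℕ k)))
  (sumℕ-distrib-+ {n} _ _)

-- Nonnegative paths of length n from height h to height 0.
pathCount : ℕ → ℕ → ℕ
pathCount zero    zero    = 1
pathCount (suc h) zero    = 0
pathCount zero    (suc n) = pathCount 0 n + pathCount 1 n
pathCount (suc h) (suc n) =
  pathCount h n + pathCount (suc h) n + pathCount (suc (suc h)) n

-- A path from height a + b + 1 splits at its first visit to height b; the
-- split is what turns pathCount 1 into the quadratic term of the recurrence.
pathCount-convolution : ∀ n a b →
  pathCount (suc (a + b)) n ≡ convolution (pathCount a) (pathCount b) n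
pathCount-convolution zero    a       b = refl
pathCount-convolution (suc n) zero    b = begin
  p b + p (suc b) + p (suc (suc b))         ≡⟨ ℕ.+-assoc (p b) _ _ ⟩
  p b + (p (suc b) + p (suc (suc b)))       ≡⟨ ≡.cong (p b +_) (≡.cong₂ _+_
                                                 (pathCount-convolution n 0 b)
                                                 (pathCount-convolution n 1 b)) ⟩
  -- The descent straight to height b is the term k = 0, where `pathCount 0 0` is 1.
  p b + (c 0 + c 1)                         ≡⟨ ≡.cong₂ _+_ (ℕ.*-identityˡ (p b))
                                                 (convolution-distribʳ-+ (pathCount 0) (pathCount 1) (pathCount b) n) ⟨
  1 * p b + convolution (λ k → pathCount 0 k + pathCount 1 k) (pathCount b) n
                                            ≡⟨ convolution-suc (pathCount 0) (pathCount b) n ⟨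
  convolution (pathCount 0) (pathCount b) (suc n) ∎
  where
  open ≡.≡-Reasoning
  p = λ h → pathCount h n
  c = λ a → convolution (pathCount a) (pathCount b) n
pathCount-convolution (suc n) (suc a) b = begin
  p (suc a + b) + p (suc (suc a + b)) + p (suc (suc (suc a) + b))
    ≡⟨ ≡.cong₂ _+_ (≡.cong₂ _+_ (pathCount-convolution n a b)
         (pathCount-convolution n (suc a) b)) (pathCount-convolution n (suc (suc a)) b) ⟩
  c a + c (suc a) + c (suc (suc a))
    ≡⟨ ≡.cong (_+ c (suc (suc a))) (convolution-distribʳ-+ (pathCount a) (pathCount (suc a)) (pathCount b) n) ⟨
  convolution (λ k → pathCount a k + pathCount (suc a) k) (pathCount b) n + c (suc (suc a))
    ≡⟨ convolution-distribʳ-+ (λ k → pathCount a k + pathCount (suc a) k) (pathCount (suc (suc a))) (pathCount b) n ⟨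
  -- The term k = 0 of `convolution-suc` carries the factor `pathCount (suc a) 0`, which computes to
  -- 0.
  convolution (pathCount (suc a) ∘ suc) (pathCount b) n
    ≡⟨ convolution-suc (pathCount (suc a)) (pathCount b) n ⟨
  convolution (pathCount (suc a)) (pathCount b) (suc n) ∎
  where
  open ≡.≡-Reasoning
  p = λ h → pathCount h n
  c = λ a → convolution (pathCount a) (pathCount b) n

-- Strong induction, as the quadratic term of the recurrence involves every shorter length.
pathCount≡motzkin : ∀ n → pathCount 0 n ≡ motzkin n
pathCount≡motzkin = <-rec _ step
  where
  step : ∀ n → (∀ {k} → k < n → pathCount 0 k ≡ motzkin k) → pathCount 0 n ≡ motzkin n
  step zero    _   = refl
  step (suc n) rec = begin
    pathCount 0 n + pathCount 1 n   ≡⟨ ≡.cong₂ _+_ (rec (ℕ.n<1+n n)) (pathCount-convolution n 0 0) ⟩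
    motzkin n + convolution (pathCount 0) (pathCount 0) n
                                    ≡⟨ ≡.cong (motzkin n +_) (sumℕ-cong {n} λ k → ≡.cong₂ _*_
                                         (rec (ℕ.m≤n⇒m≤1+n (toℕ<n k)))
                                         (rec (ℕ.m≤n⇒m≤1+n (toℕ<n (opposite k))))) ⟩
    motzkin n + convolution motzkin motzkin n
                                    ≡⟨ motzkin-suc n ⟨
    motzkin (suc n)                 ∎
    where open ≡.≡-Reasoning

-- Enumeration of the height vectors of paths

-- The successive heights of the path are h, v₁, …, vₘ, 0.
data IsPath : ℕ → ∀ {m} → Vec ℤ m → Set where
  end  : ∀ {h} → h ≤ 1 → IsPath h []
  step : ∀ {h h′ m} {v : Vec ℤ m} →
         h ≤ suc h′ → h′ ≤ suc h → IsPath h′ v → IsPath h (pos h′ ∷ v)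

prepend : ∀ {m} → ℕ → List (Vec ℤ m) → List (Vec ℤ (suc m))
prepend h = map (λ v → pos h ∷ v)

paths : ∀ m → ℕ → List (Vec ℤ m)
paths zero    zero          = [] ∷ []
paths zero    (suc zero)    = [] ∷ []
paths zero    (suc (suc _)) = []
paths (suc m) zero          = prepend 0 (paths m 0) ++ prepend 1 (paths m 1)
paths (suc m) (suc h)       =
  (prepend h (paths m h) ++ prepend (suc h) (paths m (suc h))) ++
  prepend (suc (suc h)) (paths m (suc (suc h)))

-- A vector of m inner heights belongs to a path with m + 1 steps, the last one leading to height 0.
length-paths : ∀ m h → length (paths m h) ≡ pathCount h (suc m)
length-prepend-paths : ∀ m h → length (prepend h (paths m h)) ≡ pathCount h (suc m)
length-prepend-paths m h = ≡.trans (length-map _ (paths m h)) (length-paths m h)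

length-paths zero    zero          = refl
length-paths zero    (suc zero)    = refl
length-paths zero    (suc (suc _)) = refl
length-paths (suc m) zero          = ≡.trans
  (length-++ (prepend 0 (paths m 0)))
  (≡.cong₂ _+_ (length-prepend-paths m 0) (length-prepend-paths m 1))
length-paths (suc m) (suc h)       = ≡.trans
  (length-++ (prepend h (paths m h) ++ prepend (suc h) (paths m (suc h))))
  (≡.cong₂ _+_
    (≡.trans (length-++ (prepend h (paths m h)))
      (≡.cong₂ _+_ (length-prepend-paths m h) (length-prepend-paths m (suc h))))
    (length-prepend-paths m (suc (suc h))))

paths-sound : ∀ m h {v} → v ∈ paths m h → IsPath h v
paths-sound zero    zero          (here refl) = end z≤n
paths-sound zero    (suc zero)    (here refl) = end (s≤s z≤n)
paths-sound (suc m) zero v∈ with ∈-++⁻ (prepend 0 (paths m 0)) v∈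
... | inj₁ v∈₀ with _ , w∈ , refl ← ∈-map⁻ _ v∈₀ = step z≤n z≤n (paths-sound m 0 w∈)
... | inj₂ v∈₁ with _ , w∈ , refl ← ∈-map⁻ _ v∈₁ = step z≤n ℕ.≤-refl (paths-sound m 1 w∈)
paths-sound (suc m) (suc h) v∈
  with ∈-++⁻ (prepend h (paths m h) ++ prepend (suc h) (paths m (suc h))) v∈
... | inj₂ v∈₂ with _ , w∈ , refl ← ∈-map⁻ _ v∈₂ =
  step (ℕ.m≤n+m (suc h) 2) ℕ.≤-refl (paths-sound m (suc (suc h)) w∈)
... | inj₁ v∈₀₁ with ∈-++⁻ (prepend h (paths m h)) v∈₀₁
... | inj₁ v∈₀ with _ , w∈ , refl ← ∈-map⁻ _ v∈₀ =
  step ℕ.≤-refl (ℕ.m≤n+m h 2) (paths-sound m h w∈)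
... | inj₂ v∈₁ with _ , w∈ , refl ← ∈-map⁻ _ v∈₁ =
  step (ℕ.n≤1+n _) (ℕ.n≤1+n _) (paths-sound m (suc h) w∈)

neighbours : ∀ {h h′} → suc h ≤ suc h′ → h′ ≤ suc (suc h) →
             h′ ≡ h ⊎ h′ ≡ suc h ⊎ h′ ≡ suc (suc h)
neighbours (s≤s h≤h′) h′≤2+h with ℕ.m≤n⇒m<n∨m≡n h≤h′
... | inj₂ h≡h′ = inj₁ (≡.sym h≡h′)
... | inj₁ 1+h≤h′ with ℕ.m≤n⇒m<n∨m≡n 1+h≤h′
... | inj₂ 1+h≡h′ = inj₂ (inj₁ (≡.sym 1+h≡h′))
... | inj₁ 2+h≤h′ = inj₂ (inj₂ (ℕ.≤-antisym h′≤2+h 2+h≤h′))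

paths-complete : ∀ {h m} {v : Vec ℤ m} → IsPath h v → v ∈ paths m h
paths-complete {zero}        (end _)         = here refl
paths-complete {suc zero}    (end _)         = here refl
paths-complete {suc (suc _)} (end (s≤s ()))
paths-complete {zero}  (step {h′ = zero}  _ _ p) = ∈-++⁺ˡ (∈-map⁺ _ (paths-complete p))
paths-complete {zero}  (step {h′ = suc zero} _ _ p) =
  ∈-++⁺ʳ (prepend 0 (paths _ 0)) (∈-map⁺ _ (paths-complete p))
paths-complete {zero}  (step {h′ = suc (suc _)} _ (s≤s ()) _)
paths-complete {suc h} (step lo hi p) with neighbours lo hi
... | inj₁ refl        = ∈-++⁺ˡ (∈-++⁺ˡ (∈-map⁺ _ (paths-complete p)))
... | inj₂ (inj₁ refl) =
  ∈-++⁺ˡ (∈-++⁺ʳ (prepend h (paths _ h)) (∈-map⁺ _ (paths-complete p)))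
... | inj₂ (inj₂ refl) =
  ∈-++⁺ʳ (prepend h (paths _ h) ++ prepend (suc h) (paths _ (suc h)))
    (∈-map⁺ _ (paths-complete p))

-- Lists prepended with different heights are disjoint, because their members have different heads.
head-of-prepend : ∀ {m h} {v : Vec ℤ (suc m)} {xs} → v ∈ prepend h xs → Vec.head v ≡ pos h
head-of-prepend v∈ with _ , _ , refl ← ∈-map⁻ _ v∈ = refl

paths-unique : ∀ m h → Unique (paths m h)
paths-unique zero    zero          = [] ∷ []
paths-unique zero    (suc zero)    = [] ∷ []
paths-unique zero    (suc (suc _)) = []
paths-unique (suc m) zero          = Unique.++⁺
  (Unique.map⁺ ∷-injectiveʳ (paths-unique m 0))
  (Unique.map⁺ ∷-injectiveʳ (paths-unique m 1))
  (λ (v∈₀ , v∈₁) → contradiction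
    (ℤ.+-injective (≡.trans (≡.sym (head-of-prepend v∈₀)) (head-of-prepend v∈₁))) λ ())
paths-unique (suc m) (suc h)       = Unique.++⁺
  (Unique.++⁺
    (Unique.map⁺ ∷-injectiveʳ (paths-unique m h))
    (Unique.map⁺ ∷-injectiveʳ (paths-unique m (suc h)))
    λ (v∈₀ , v∈₁) → ℕ.m≢1+m+n h
      (≡.trans (ℤ.+-injective (≡.trans (≡.sym (head-of-prepend v∈₀)) (head-of-prepend v∈₁)))
             (≡.cong suc (≡.sym (ℕ.+-identityʳ h)))))
  (Unique.map⁺ ∷-injectiveʳ (paths-unique m (suc (suc h))))
  λ (v∈₀₁ , v∈₂) → disjoint (∈-++⁻ (prepend h (paths m h)) v∈₀₁) (head-of-prepend v∈₂)
  where
  disjoint : ∀ {v : Vec ℤ (suc m)} →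
    v ∈ prepend h (paths m h) ⊎ v ∈ prepend (suc h) (paths m (suc h)) →
    ¬ Vec.head v ≡ pos (suc (suc h))
  disjoint (inj₁ v∈₀) eq = ℕ.m≢1+n+m h
    (ℤ.+-injective (≡.trans (≡.sym (head-of-prepend v∈₀)) eq))
  disjoint (inj₂ v∈₁) eq = ℕ.m≢1+n+m (suc h) {0}
    (ℤ.+-injective (≡.trans (≡.sym (head-of-prepend v∈₁)) eq))

-- Recognising a path from its heights, and bounds on the heights

isPath-tabulated : ∀ {h m} (v : Vec ℤ m) (g : Fin m → ℕ) → (∀ i → lookup v i ≡ pos (g i)) →
  (∀ i → toℕ i ≡ 0 → h ≤ suc (g i) × g i ≤ suc h) →
  (∀ i j → toℕ j ≡ suc (toℕ i) → g i ≤ suc (g j) × g j ≤ suc (g i)) →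
  (∀ i → suc (toℕ i) ≡ m → g i ≤ 1) → (m ≡ 0 → h ≤ 1) →
  IsPath h v
isPath-tabulated []      g v≡g first next last none = end (none refl)
isPath-tabulated (x ∷ v) g v≡g first next last none with refl ← v≡g zero =
  step (proj₁ (first zero refl)) (proj₂ (first zero refl))
    -- The tail starts at `g zero`: the condition `next` out of index zero becomes `first`, and
    -- `last` at zero becomes `none`.
    (isPath-tabulated v (g ∘ suc) (v≡g ∘ suc)
      (λ i i≡0 → next zero (suc i) (≡.cong suc i≡0))
      (λ i j j≡1+i → next (suc i) (suc j) (≡.cong suc j≡1+i))
      (λ i i≡m → last (suc i) (≡.cong suc i≡m))
      (λ m≡0 → last zero (≡.cong suc (≡.sym m≡0))))

-- The entries of a path are nonnegative, so the absolute value recovers them as natural numbers.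
height : ∀ {m} → Vec ℤ m → Fin m → ℕ
height v i = ∣ lookup v i ∣

lookup-isPath : ∀ {h m} {v : Vec ℤ m} → IsPath h v → ∀ i → lookup v i ≡ pos (height v i)
lookup-isPath (step _ _ p) zero    = refl
lookup-isPath (step _ _ p) (suc i) = lookup-isPath p i

start≤length : ∀ {h m} {v : Vec ℤ m} → IsPath h v → h ≤ suc m
start≤length (end h≤1)          = h≤1
start≤length (step h≤1+h′ _ p)  = ℕ.≤-trans h≤1+h′ (s≤s (start≤length p))

height-from-start : ∀ {h m} {v : Vec ℤ m} → IsPath h v → ∀ i →
  h ≤ suc (toℕ i) + height v i × height v i ≤ suc (toℕ i) + h
height-from-start (step lo hi p) zero    = lo , hi
height-from-start (step lo hi p) (suc i) =
  ℕ.≤-trans lo (s≤s (proj₁ (height-from-start p i))) ,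
  ℕ.≤-trans (proj₂ (height-from-start p i))
    (ℕ.≤-trans (ℕ.+-monoʳ-≤ (suc (toℕ i)) hi) (ℕ.≤-reflexive (ℕ.+-suc (suc (toℕ i)) _)))

-- Read with the dimension `suc (toℕ i)`, this says that the window ends within the m + 1
-- coordinates.
height-to-end : ∀ {h m} {v : Vec ℤ m} → IsPath h v → ∀ i → toℕ i + height v i ≤ m
height-to-end (step _ _ p) zero    = start≤length p
height-to-end (step _ _ p) (suc i) = s≤s (height-to-end p i)

-- The two bounds express, without subtraction, that i + hᵢ and i - hᵢ increase weakly; these are
-- the ends of the window.
height-lipschitz : ∀ {h m} {v : Vec ℤ m} → IsPath h v → ∀ {i j} → i Fin.< j →
  toℕ i + height v i ≤ toℕ j + height v j × toℕ i + height v j ≤ toℕ j + height v i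
height-lipschitz (step _ _ p) {zero}  {suc j} _         = height-from-start p j
height-lipschitz (step _ _ p) {suc i} {suc j} (s≤s i<j) =
  s≤s (proj₁ (height-lipschitz p i<j)) , s≤s (proj₂ (height-lipschitz p i<j))

-- Counting points of subspaces

funToFin-cong : ∀ {m n} {f g : Fin m → Fin n} → f ≗ g → funToFin f ≡ funToFin g
funToFin-cong {zero}  f≗g = refl
funToFin-cong {suc m} f≗g = ≡.cong₂ combine (f≗g zero) (funToFin-cong (f≗g ∘ suc))

remQuot-injective : ∀ {m} n {i j : Fin (m * n)} → remQuot {m} n i ≡ remQuot {m} n j → i ≡ j
remQuot-injective {m} n {i} {j} eq = ≡.trans (≡.sym (combine-remQuot {m} n i))
  (≡.trans (≡.cong (λ (x , y) → combine x y) eq) (combine-remQuot {m} n j))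

-- g codes the fibre of f through y, relative to its point y.
fibres-bound : ∀ {N M K} (f : Fin N → Fin M) (g : ∀ x y → f x ≡ f y → Fin K) →
  (∀ {x x′ y} p p′ → g x y p ≡ g x′ y p′ → x ≡ x′) → N ≤ M * K
fibres-bound {N} {M} {K} f g g-injective = injective⇒≤ {f = code} code-injective
  where
  -- Irrelevance of the second argument makes the representative depend on z only.
  representative : ∀ z → .(∃[ x ] z ≡ f x) → ∃[ x ] z ≡ f x
  representative z z∈ with any? (λ x → z ≟ f x)
  ... | yes x,z≡fx = x,z≡fx
  ... | no  z∉     = contradiction-irr z∈ z∉

  rep : ∀ x → ∃[ y ] f x ≡ f y
  rep x = representative (f x) (x , refl)

  rep-cong : ∀ {z z′} → z ≡ z′ → .(p : ∃[ x ] z ≡ f x) .(p′ : ∃[ x ] z′ ≡ f x) →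
    proj₁ (representative z p) ≡ proj₁ (representative z′ p′)
  rep-cong refl _ _ = refl

  code : Fin N → Fin (M * K)
  code x = combine (f x) (g x (proj₁ (rep x)) (proj₂ (rep x)))

  g-injective′ : ∀ {x x′ y y′} p p′ → y ≡ y′ → g x y p ≡ g x′ y′ p′ → x ≡ x′
  g-injective′ p p′ refl = g-injective p p′

  code-injective : ∀ {x x′} → code x ≡ code x′ → x ≡ x′
  code-injective {x} {x′} eq with combine-injective (f x) _ (f x′) _ eq
  -- Equal codes give equal values of f and hence the same representative, so g codes both points
  -- relative to one y.
  ... | fx≡fx′ , gx≡gx′ = g-injective′ _ _ (rep-cong fx≡fx′ _ _) gx≡gx′

primePower>1 : ∀ {q} → IsPrimePower q → 1 < q
primePower>1 (p , k , prime _ , 1≤k , refl) =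
  ℕ.≤-trans (ℕ.≤-reflexive (≡.sym (ℕ.*-identityʳ 2)))
    (ℕ.≤-trans (ℕ.*-monoˡ-≤ 1 (nonTrivial⇒n>1 p))
      (ℕ.^-monoʳ-≤ p {{nonTrivial⇒nonZero p}} 1≤k))

-- Translates an inequality between point counts back to dimensions; 1 < q makes the powers of q
-- strictly increasing.
^-cancelʳ-≤ : ∀ {q} → 1 < q → ∀ {k l} → q ^ k ≤ q ^ l → k ≤ l
^-cancelʳ-≤ {q} 1<q {k} {l} le with k ℕ.≤? l
... | yes k≤l = k≤l
... | no  k≰l = contradiction (ℕ.^-monoʳ-< q 1<q (ℕ.≰⇒> k≰l)) (ℕ.≤⇒≯ le)

suc-∸-≤ : ∀ m n → suc m ∸ n ≤ suc (m ∸ n)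
suc-∸-≤ m       zero    = ℕ.≤-refl
suc-∸-≤ zero    (suc n) = ℕ.≤-trans (ℕ.m∸n≤m 0 n) z≤n
suc-∸-≤ (suc m) (suc n) = suc-∸-≤ m n

-- Extracts from `dim-⊓-bound` the case of two spaces of dimension k inside spaces of dimension k +
-- 1: the intersection gains at most 2 dimensions.
codimension-arithmetic : ∀ k {w m} → k + (k + w) ≤ (suc k + suc k) + m → w ≤ suc (suc m)
codimension-arithmetic k {w} {m} le =
  ℕ.+-cancelˡ-≤ k _ _ (ℕ.+-cancelˡ-≤ k _ _ (ℕ.≤-trans le (ℕ.≤-reflexive (rearrange k m))))
  where
  rearrange : ∀ k m → (suc k + suc k) + m ≡ k + (k + suc (suc m))
  rearrange = solve-∀

-- Index sets of the coordinate flags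

-- A derivation scans the indices below n in order and records k hits; `coordinate-dim` recurses on
-- it to build a basis.
data Count : (ℕ → Bool) → ℕ → ℕ → Set where
  done : ∀ {P} → Count P 0 0
  hit  : ∀ {P n k} → P 0 ≡ true → Count (P ∘ suc) n k → Count P (suc n) (suc k)
  miss : ∀ {P n k} → P 0 ≡ false → Count (P ∘ suc) n k → Count P (suc n) k

count-all : ∀ n → Count (λ _ → true) n n
count-all zero    = done
count-all (suc n) = hit refl (count-all n)

count-initial : ∀ {x n} → x ≤ n → Count (_<ᵇ x) n x
count-initial {n = zero}  z≤n       = done
count-initial {n = suc n} z≤n       = miss refl (count-initial {n = n} z≤n)
count-initial             (s≤s x≤n) = hit refl (count-initial x≤n)

-- `alternate true` selects the even numbers and `alternate false` the odd ones.
alternate : Bool → ℕ → Bool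
alternate p zero    = p
alternate p (suc j) = alternate (not p) j

alternate-not : ∀ p j → alternate (not p) j ≡ not (alternate p j)
alternate-not p zero    = refl
alternate-not p (suc j) = alternate-not (not p) j

-- The parity is that of j itself, not of its offset in the window, so that raising either end never
-- drops an index.
window : Bool → ℕ → ℕ → ℕ → Bool
window p x y j = (j <ᵇ x) ∨ ((j <ᵇ y) ∧ alternate p j)

count-window : ∀ p x h {n} → x + h * 2 ≤ n → Count (window p x (x + h * 2)) n (x + h)
count-window p     (suc x) h       {suc n}       (s≤s le)       = hit refl (count-window (not p) x h le)
count-window p     zero    zero    {zero}        _              = done
count-window p     zero    zero    {suc n}       _              = miss refl (count-window (not p) 0 0 z≤n)
-- Of two consecutive indices exactly one has the chosen parity, and two negations of a concrete `p`
-- cancel by computation.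
count-window true  zero    (suc h) {suc (suc n)} (s≤s (s≤s le)) =
  hit refl (miss refl (count-window true 0 h le))
count-window false zero    (suc h) {suc (suc n)} (s≤s (s≤s le)) =
  miss refl (hit refl (count-window false 0 h le))

-- Stated through the value `false`, since membership in `coordinate` demands vanishing where the
-- predicate is false.
<ᵇ-mono : ∀ {x x′} → x ≤ x′ → ∀ j → (j <ᵇ x′) ≡ false → (j <ᵇ x) ≡ false
<ᵇ-mono z≤n        j       _  = refl
<ᵇ-mono (s≤s x≤x′) (suc j) eq = <ᵇ-mono x≤x′ j eq

window-mono : ∀ p {x x′ y y′} → x ≤ x′ → y ≤ y′ → ∀ j →
  window p x′ y′ j ≡ false → window p x y j ≡ false
window-mono p {x} {x′} {y} {y′} x≤x′ y≤y′ j = go (alternate p j) (<ᵇ-mono x≤x′ j) (<ᵇ-mono y≤y′ j)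
  where
  go : ∀ {a a′ b b′} c → (a′ ≡ false → a ≡ false) → (b′ ≡ false → b ≡ false) →
    a′ ∨ (b′ ∧ c) ≡ false → a ∨ (b ∧ c) ≡ false
  go {a′ = false} {b} {true}  false a⇒ _  _ rewrite a⇒ refl = ∧-zeroʳ b
  go {a′ = false} {b} {false} c     a⇒ b⇒ _ rewrite a⇒ refl | b⇒ refl = refl

window-false⇒≥ : ∀ p x y j → window p x y j ≡ false → (j <ᵇ x) ≡ false
window-false⇒≥ p x y j eq with j <ᵇ x
... | false = refl

-- An index at or beyond x has only one parity, so windows of opposite parity share just the indices
-- below x.
outside-window : ∀ x y j → (j <ᵇ x) ≡ false →
  window false x y j ≡ false ⊎ window true x y j ≡ false
outside-window x y j j≮x rewrite j≮x | alternate-not false j with alternate false j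
... | false = inj₁ (∧-zeroʳ (j <ᵇ y))
... | true  = inj₂ (∧-zeroʳ (j <ᵇ y))

-- Subspaces and flags over F

module LinearAlgebra {c ℓ₁ ℓ₂ : Level} (F : HeytingField c ℓ₁ ℓ₂) where

  open CommutativeRing (commutativeRing F) renaming
    (_+_ to _+ᶠ_; _*_ to _*ᶠ_; -_ to -ᶠ_; _-_ to _-ᶠ_)
    hiding (zero; refl; sym; trans)
  open CommutativeRing (commutativeRing F) using () renaming
    (refl to ≈-refl; sym to ≈-sym; trans to ≈-trans)
  open CommutativeMonoidSum +-commutativeMonoid using
    (sum; sum-cong-≋; ∑-distrib-+; sum-replicate-zero)
  open VectorEquality setoid using (_≋_)
  open RingProperties ring using (-1*x≈-x; x∙y⁻¹≈ε⇒x≈y; +-cancelʳ)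
  open Subspace
  open IsBasis
  module ≈-Reasoning = SetoidReasoning setoid

  private variable
    n k l : ℕ

  -ᶠ-cancel : ∀ x y → (x -ᶠ y) +ᶠ y ≈ x
  -ᶠ-cancel x y = ≈-trans (+-assoc x (-ᶠ y) y)
    (≈-trans (+-congˡ (-‿inverseˡ y)) (+-identityʳ x))

  minus-closed : (U : Subspace F n) → ∀ {u v} → member U u → member U v →
                 member U (λ j → u j -ᶠ v j)
  minus-closed U u∈U v∈U = resp-≋ U (λ j → +-congˡ (-1*x≈-x _))
    (+-closed U u∈U (*-closed U (-ᶠ 1#) v∈U))

  linearCombination-minus : ∀ (a a′ : Vector Carrier k) (b : Vector (Vector Carrier n) k) → ∀ j →
    linearCombination F (λ i → a i -ᶠ a′ i) b j +ᶠ linearCombination F a′ b j ≈ linearCombination F a b j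
  linearCombination-minus a a′ b j = ≈-trans
    (≈-sym (∑-distrib-+ (λ i → (a i -ᶠ a′ i) *ᶠ b i j) (λ i → a′ i *ᶠ b i j)))
    (sum-cong-≋ λ i → ≈-trans (≈-sym (distribʳ (b i j) (a i -ᶠ a′ i) (a′ i)))
                              (*-congʳ (-ᶠ-cancel (a i) (a′ i))))

  linearCombination-injective : ∀ {U : Subspace F n} {b : Vector (Vector Carrier n) k} →
    IsBasis F U b → ∀ a a′ → linearCombination F a b ≋ linearCombination F a′ b → a ≋ a′
  linearCombination-injective {b = b} isBasis a a′ eq i =
    x∙y⁻¹≈ε⇒x≈y _ _ (independent isBasis (λ i → a i -ᶠ a′ i) vanishes i)
    where
    vanishes : linearCombination F (λ i → a i -ᶠ a′ i) b ≋ (λ _ → 0#)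
    vanishes j = +-cancelʳ (linearCombination F a′ b j) _ _
      (≈-trans (linearCombination-minus a a′ b j)
        (≈-trans (eq j) (≈-sym (+-identityˡ _))))

  HasDim-resp : {U V : Subspace F n} → member U ⊆ member V → member V ⊆ member U →
                HasDim F U k → HasDim F V k
  HasDim-resp U⊆V V⊆U (b , isBasis) = b , record
    { inside      = λ i → U⊆V (inside isBasis i)
    ; independent = independent isBasis
    ; spanning    = λ v v∈V → spanning isBasis v (V⊆U v∈V)
    }

  -- Defined by vanishing coordinates rather than as a span, so that inclusions and intersections
  -- are checked coordinatewise; `Lift` adjusts the universe level.
  coordinate : (ℕ → Bool) → ∀ n → Subspace F n
  coordinate P n = record
    { member   = λ v → Lift c (∀ j → P (toℕ j) ≡ false → v j ≈ 0#)
    ; resp-≋   = λ u≋v (lift u∈) → lift λ j Pj → ≈-trans (≈-sym (u≋v j)) (u∈ j Pj)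
    ; 0-closed = lift λ _ _ → ≈-refl
    ; +-closed = λ (lift u∈) (lift v∈) → lift λ j Pj →
        ≈-trans (+-cong (u∈ j Pj) (v∈ j Pj)) (+-identityˡ 0#)
    ; *-closed = λ a (lift v∈) → lift λ j Pj → ≈-trans (*-congˡ (v∈ j Pj)) (zeroʳ a)
    }

  coordinate-mono : ∀ {P Q} → (∀ j → Q j ≡ false → P j ≡ false) →
    member (coordinate P n) ⊆ member (coordinate Q n)
  coordinate-mono Q⇒P (lift v∈) = lift λ j Qj → v∈ j (Q⇒P (toℕ j) Qj)

  sum-zeroʳ : ∀ (a : Vector Carrier k) → sum (λ i → a i *ᶠ 0#) ≈ 0#
  sum-zeroʳ {k} a = ≈-trans (sum-cong-≋ λ i → zeroʳ (a i)) (sum-replicate-zero k)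

  -- The basis consists of the standard vectors at the hits; the recursion strips the first
  -- coordinate.
  coordinate-dim : ∀ {P} → Count P n k → HasDim F (coordinate P n) k
  coordinate-dim done = (λ ()) , record
    { inside = λ () ; independent = λ _ _ () ; spanning = λ _ _ → (λ ()) , λ () }
  coordinate-dim (miss P0 count) with b , isBasis ← coordinate-dim count =
    (λ i → 0# V.∷ b i) , record
    { inside      = λ i → lift λ where
        zero    _  → ≈-refl
        (suc j) Pj → lower (inside isBasis i) j Pj
    ; independent = λ a a≋0 → independent isBasis a (a≋0 ∘ suc)
    ; spanning    = λ v (lift v∈) →
        let a , v≋ = spanning isBasis (v ∘ suc) (lift (v∈ ∘ suc)) in
        a , λ where
          zero    → ≈-trans (v∈ zero P0) (≈-sym (sum-zeroʳ a))
          (suc j) → v≋ j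
    }
  coordinate-dim {P = P} (hit {n = n} {k} P0 count) with b , isBasis ← coordinate-dim count =
    extended , record
    { inside      = λ where
        zero    → lift λ where
          zero    ¬P0 → contradiction (≡.trans (≡.sym P0) ¬P0) λ ()
          (suc j) _   → ≈-refl
        (suc i) → lift λ where
          zero    _  → ≈-refl
          (suc j) Pj → lower (inside isBasis i) j Pj
    ; independent = λ a a≋0 → λ where
        zero    → ≈-trans (≈-sym (head-coordinate a)) (a≋0 zero)
        (suc i) → independent isBasis (a ∘ suc)
          (λ j → ≈-trans (≈-sym (tail-coordinate a j)) (a≋0 (suc j))) i
    ; spanning    = λ v (lift v∈) →
        let a , v≋ = spanning isBasis (v ∘ suc) (lift (v∈ ∘ suc)) in
        v zero V.∷ a , λ where
          zero    → ≈-sym (head-coordinate (v zero V.∷ a))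
          (suc j) → ≈-trans (v≋ j) (≈-sym (tail-coordinate (v zero V.∷ a) j))
    }
    where
    extended : Vector (Vector Carrier (suc n)) (suc k)
    extended = (1# V.∷ λ _ → 0#) V.∷ λ i → 0# V.∷ b i

    head-coordinate : ∀ a → linearCombination F a extended zero ≈ a zero
    head-coordinate a = ≈-trans (+-cong (*-identityʳ (a zero)) (sum-zeroʳ (a ∘ suc))) (+-identityʳ _)

    tail-coordinate : ∀ a j → linearCombination F a extended (suc j) ≈ linearCombination F (a ∘ suc) b j
    tail-coordinate a j = ≈-trans (+-congʳ (zeroʳ (a zero))) (+-identityˡ _)

  full : ∀ n → Subspace F n
  full = coordinate (λ _ → true)

  ⊆-full : {U : Subspace F n} → member U ⊆ member (full n)
  ⊆-full _ = lift λ _ ()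

  full-dim : ∀ n → HasDim F (full n) n
  full-dim n = coordinate-dim (count-all n)

  -- Two injections instead of a bijection: `encode` may depend on the membership proof and on the
  -- representative under `_≋_`, and comparing cardinalities takes injectivity only.
  record Coding (U : Subspace F n) (N : ℕ) : Set (c ⊔ ℓ₁) where
    field
      encode           : ∀ v → member U v → Fin N
      encode-injective : ∀ {u v} u∈U v∈U → encode u u∈U ≡ encode v v∈U → u ≋ v
      decode           : Fin N → Vector Carrier n
      decode∈          : ∀ x → member U (decode x)
      decode-injective : ∀ {x y} → decode x ≋ decode y → x ≡ y

  open Coding

  -- Dimension inequalities from point counts

  module _ {q : ℕ} (1<q : 1 < q) (order : HasOrder F q) where

    open Inverse order using (to; from; to-cong; from-cong; strictlyInverseˡ; strictlyInverseʳ)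

    to-injective : ∀ {x y} → to x ≡ to y → x ≈ y
    to-injective {x} {y} eq = ≈-trans (≈-sym (strictlyInverseʳ x))
      (≈-trans (from-cong eq) (strictlyInverseʳ y))

    from-injective : ∀ {i j} → from i ≈ from j → i ≡ j
    from-injective {i} {j} eq = ≡.trans (≡.sym (strictlyInverseˡ i))
      (≡.trans (to-cong eq) (strictlyInverseˡ j))

    -- The coefficients with respect to the basis are read as k digits in base q.
    coding : {U : Subspace F n} → HasDim F U k → Coding U (q ^ k)
    coding {n = n} {k = k} {U = U} (b , isBasis) = record
      { encode           = λ v v∈U → funToFin (to ∘ proj₁ (spanning isBasis v v∈U))
      ; encode-injective = enc-inj
      ; decode           = dec
      ; decode∈          = λ x → combination∈ (coefficients x) b (inside isBasis)
      ; decode-injective = λ {x} {y} eq → ≡.trans (≡.sym (funToFin-finToFin {k} {q} x))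
          (≡.trans (funToFin-cong λ i → from-injective
                     (linearCombination-injective {U = U} isBasis (coefficients x) (coefficients y) eq i))
                   (funToFin-finToFin {k} {q} y))
      }
      where
      coefficients : Fin (q ^ k) → Vector Carrier k
      coefficients x = from ∘ finToFun x

      dec : Fin (q ^ k) → Vector Carrier n
      dec x = linearCombination F (coefficients x) b

      combination∈ : ∀ {l} (a : Vector Carrier l) (b : Vector (Vector Carrier n) l) →
        (∀ i → member U (b i)) → member U (linearCombination F a b)
      combination∈ {zero}  a b b∈U = 0-closed U
      combination∈ {suc l} a b b∈U = +-closed U (*-closed U (a zero) (b∈U zero))
        (combination∈ (a ∘ suc) (b ∘ suc) (b∈U ∘ suc))

      enc-inj : ∀ {u v} (u∈U : member U u) (v∈U : member U v) →
        funToFin (to ∘ proj₁ (spanning isBasis u u∈U)) ≡ funToFin (to ∘ proj₁ (spanning isBasis v v∈U)) →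
        u ≋ v
      enc-inj {u} {v} u∈U v∈U eq j with spanning isBasis u u∈U | spanning isBasis v v∈U
      ... | a , u≋ | a′ , v≋ = ≈-trans (u≋ j) (≈-trans
        (sum-cong-≋ λ i → *-congʳ (to-injective (≡.trans (≡.sym (finToFun-funToFin (to ∘ a) i))
          (≡.trans (≡.cong (λ x → finToFun x i) eq) (finToFun-funToFin (to ∘ a′) i)))))
        (≈-sym (v≋ j)))

    -- Decoding in U and encoding in V injects q ^ k points into q ^ l.
    dim-mono : {U V : Subspace F n} → HasDim F U k → HasDim F V l →
               member U ⊆ member V → k ≤ l
    dim-mono {U = U} {V} dimU dimV U⊆V = ^-cancelʳ-≤ 1<q (injective⇒≤
      {f = λ x → encode codeV (decode codeU x) (U⊆V (decode∈ codeU x))}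
      λ eq → decode-injective codeU
        (encode-injective codeV (U⊆V (decode∈ codeU _)) (U⊆V (decode∈ codeU _)) eq))
      where
      codeU = coding {U = U} dimU
      codeV = coding {U = V} dimV

    dim-unique : {U : Subspace F n} → HasDim F U k → HasDim F U l → k ≡ l
    dim-unique {U = U} dim dim′ =
      ℕ.≤-antisym (dim-mono {U = U} {U} dim dim′ id) (dim-mono {U = U} {U} dim′ dim id)

    -- The map (u , u′ , w) ↦ (u + w , u′ + w) from U × U′ × (V ⊓ V′) to V × V′
    -- is linear, and its kernel is isomorphic to U ⊓ U′ through w.
    dim-⊓-bound : {U U′ V V′ : Subspace F n} {k k′ l l′ m w : ℕ} →
      member U ⊆ member V → member U′ ⊆ member V′ →
      HasDim F U k → HasDim F U′ k′ → HasDim F V l → HasDim F V′ l′ →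
      HasDim F (_⊓_ F V V′) w → HasDim F (_⊓_ F U U′) m →
      k + (k′ + w) ≤ (l + l′) + m
    dim-⊓-bound {n = n} {U} {U′} {V} {V′} {k} {k′} {l} {l′} {m} {w}
      U⊆V U′⊆V′ dimU dimU′ dimV dimV′ dimW dimX =
      -- The image has at most q ^ (l + l′) points and each fibre at most q ^ m.
      ^-cancelʳ-≤ 1<q (ℕ.≤-trans (ℕ.≤-reflexive domain) (ℕ.≤-trans
        (fibres-bound image difference difference-injective) (ℕ.≤-reflexive (≡.sym codomain))))
      where
      cU  = coding {U = U} dimU
      cU′ = coding {U = U′} dimU′
      cV  = coding {U = V} dimV
      cV′ = coding {U = V′} dimV′
      cW  = coding {U = _⊓_ F V V′} dimW
      cX  = coding {U = _⊓_ F U U′} dimX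

      domain : q ^ (k + (k′ + w)) ≡ q ^ k * (q ^ k′ * q ^ w)
      domain = ≡.trans (ℕ.^-distribˡ-+-* q k (k′ + w)) (≡.cong (q ^ k *_) (ℕ.^-distribˡ-+-* q k′ w))

      codomain : q ^ ((l + l′) + m) ≡ (q ^ l * q ^ l′) * q ^ m
      codomain = ≡.trans (ℕ.^-distribˡ-+-* q (l + l′) m) (≡.cong (_* q ^ m) (ℕ.^-distribˡ-+-* q l l′))

      D = Fin (q ^ k * (q ^ k′ * q ^ w))

      split : D → Fin (q ^ k) × Fin (q ^ k′ * q ^ w)
      split = remQuot {q ^ k} (q ^ k′ * q ^ w)

      split′ : D → Fin (q ^ k′) × Fin (q ^ w)
      split′ = remQuot {q ^ k′} (q ^ w) ∘ proj₂ ∘ split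

      u u′ ω v v′ : D → Vector Carrier n
      u  = decode cU ∘ proj₁ ∘ split
      u′ = decode cU′ ∘ proj₁ ∘ split′
      ω  = decode cW ∘ proj₂ ∘ split′
      v  x j = u x j +ᶠ ω x j
      v′ x j = u′ x j +ᶠ ω x j

      ω∈ : ∀ x → member (_⊓_ F V V′) (ω x)
      ω∈ x = decode∈ cW _

      v∈ : ∀ x → member V (v x)
      v∈ x = +-closed V (U⊆V (decode∈ cU _)) (proj₁ (ω∈ x))

      v′∈ : ∀ x → member V′ (v′ x)
      v′∈ x = +-closed V′ (U′⊆V′ (decode∈ cU′ _)) (proj₂ (ω∈ x))

      image : D → Fin (q ^ l * q ^ l′)
      image x = combine (encode cV (v x) (v∈ x)) (encode cV′ (v′ x) (v′∈ x))

      image-injective : ∀ x y → image x ≡ image y → v x ≋ v y × v′ x ≋ v′ y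
      image-injective x y eq with combine-injective (encode cV (v x) (v∈ x)) _ (encode cV (v y) (v∈ y)) _ eq
      ... | vx≡vy , v′x≡v′y =
        encode-injective cV (v∈ x) (v∈ y) vx≡vy , encode-injective cV′ (v′∈ x) (v′∈ y) v′x≡v′y

      swap-minus : ∀ {a b a₀ b₀} → a +ᶠ b ≈ a₀ +ᶠ b₀ → a₀ -ᶠ a ≈ b -ᶠ b₀
      swap-minus {a} {b} {a₀} {b₀} eq = +-cancelʳ (a +ᶠ b₀) _ _ (begin
        (a₀ -ᶠ a) +ᶠ (a +ᶠ b₀) ≈⟨ +-assoc _ a b₀ ⟨
        ((a₀ -ᶠ a) +ᶠ a) +ᶠ b₀ ≈⟨ +-congʳ (-ᶠ-cancel a₀ a) ⟩
        a₀ +ᶠ b₀               ≈⟨ eq ⟨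
        a +ᶠ b                 ≈⟨ +-comm a b ⟩
        b +ᶠ a                 ≈⟨ +-congʳ (-ᶠ-cancel b b₀) ⟨
        ((b -ᶠ b₀) +ᶠ b₀) +ᶠ a ≈⟨ +-assoc _ b₀ a ⟩
        (b -ᶠ b₀) +ᶠ (b₀ +ᶠ a) ≈⟨ +-congˡ (+-comm b₀ a) ⟩
        (b -ᶠ b₀) +ᶠ (a +ᶠ b₀) ∎)
        where open ≈-Reasoning

      δ : D → D → Vector Carrier n
      δ x y j = ω x j -ᶠ ω y j

      -- On a fibre u x + ω x = u y + ω y, so ω x - ω y = u y - u x lies in U; the same with u′ puts
      -- it in U′.
      δ∈ : ∀ x y → image x ≡ image y → member (_⊓_ F U U′) (δ x y)
      δ∈ x y eq =
        resp-≋ U (λ j → swap-minus (proj₁ (image-injective x y eq) j))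
          (minus-closed U (decode∈ cU _) (decode∈ cU _)) ,
        resp-≋ U′ (λ j → swap-minus (proj₂ (image-injective x y eq) j))
          (minus-closed U′ (decode∈ cU′ _) (decode∈ cU′ _))

      difference : ∀ x y → image x ≡ image y → Fin (q ^ m)
      difference x y eq = encode cX (δ x y) (δ∈ x y eq)

      -- For fixed y the difference determines ω x, and then the common image determines u x and u′
      -- x.
      difference-injective : ∀ {x x′ y} p p′ → difference x y p ≡ difference x′ y p′ → x ≡ x′
      difference-injective {x} {x′} {y} p p′ eq = remQuot-injective {q ^ k} _
        (≡.cong₂ _,_ (decode-injective cU u≋) (remQuot-injective {q ^ k′} _
          (≡.cong₂ _,_ (decode-injective cU′ u′≋) (decode-injective cW ω≋))))
        where
        ω≋ : ω x ≋ ω x′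
        ω≋ j = +-cancelʳ (-ᶠ ω y j) _ _ (encode-injective cX (δ∈ x y p) (δ∈ x′ y p′) eq j)

        image≋ : v x ≋ v x′ × v′ x ≋ v′ x′
        image≋ = image-injective x x′ (≡.trans p (≡.sym p′))

        u≋ : u x ≋ u x′
        u≋ j = +-cancelʳ (ω x j) _ _ (≈-trans (proj₁ image≋ j) (+-congˡ (≈-sym (ω≋ j))))

        u′≋ : u′ x ≋ u′ x′
        u′≋ j = +-cancelʳ (ω x j) _ _ (≈-trans (proj₂ image≋ j) (+-congˡ (≈-sym (ω≋ j))))

    -- Distance vectors are paths

    module _ {m : ℕ} (𝓕 𝓖 : FullFlag F (suc m)) {d : Vec ℤ m} (isDistance : IsDistanceVector F 𝓕 𝓖 d) where

      open FullFlag

      common : Fin m → ℕ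
      common i = proj₁ (proj₂ (isDistance i))

      common-dim : ∀ i → HasDim F (_⊓_ F (space 𝓕 i) (space 𝓖 i)) (common i)
      common-dim i with _ , _ , _ , _ , dim⊓ , _ ← isDistance i = dim⊓

      -- Truncated subtraction is exact here, by `common≤`.
      distance : Fin m → ℕ
      distance i = suc (toℕ i) ∸ common i

      common≤ : ∀ i → common i ≤ suc (toℕ i)
      common≤ i = dim-mono {U = _⊓_ F (space 𝓕 i) (space 𝓖 i)} {V = space 𝓕 i}
        (common-dim i) (dim 𝓕 i) proj₁

      lookup-distance : ∀ i → lookup d i ≡ pos (distance i)
      lookup-distance i with isDistance i | common≤ i
      ... | k , c , dimF , _ , _ , eq | c≤
        -- The dimension recorded with the distance is that of the flag member, by uniqueness.
        with refl ← dim-unique {U = space 𝓕 i} dimF (dim 𝓕 i) =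
        ≡.trans eq (≡.trans (ℤ.m-n≡m⊖n (suc (toℕ i)) c) (ℤ.⊖-≥ c≤))

      distance-first : ∀ i → toℕ i ≡ 0 → 0 ≤ suc (distance i) × distance i ≤ 1
      distance-first i i≡0 = z≤n ,
        ℕ.≤-trans (ℕ.m∸n≤m _ (common i)) (ℕ.≤-reflexive (≡.cong suc i≡0))

      distance-next : ∀ i j → toℕ j ≡ suc (toℕ i) →
        distance i ≤ suc (distance j) × distance j ≤ suc (distance i)
      distance-next i j j≡1+i rewrite j≡1+i =
        -- Adding 2 on both sides of the subtraction leaves `distance i` unchanged and brings it
        -- into the form of `common-drop`.
        ℕ.≤-trans (ℕ.∸-monoʳ-≤ (2 + suc (toℕ i)) common-drop) (suc-∸-≤ (suc (suc (toℕ i))) (common j)) ,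
        ℕ.≤-trans (ℕ.∸-monoʳ-≤ (suc (suc (toℕ i))) common-grow) (suc-∸-≤ (suc (toℕ i)) (common i))
        where
        i<j : i Fin.< j
        i<j = ℕ.≤-reflexive (≡.sym j≡1+i)

        F⊆ = proj₁ (strict 𝓕 i<j)
        G⊆ = proj₁ (strict 𝓖 i<j)

        common-grow : common i ≤ common j
        common-grow = dim-mono
          {U = _⊓_ F (space 𝓕 i) (space 𝓖 i)} {V = _⊓_ F (space 𝓕 j) (space 𝓖 j)}
          (common-dim i) (common-dim j) (λ (v∈F , v∈G) → F⊆ v∈F , G⊆ v∈G)

        dim-suc : (𝓗 : FullFlag F (suc m)) → HasDim F (space 𝓗 j) (suc (suc (toℕ i)))
        dim-suc 𝓗 = ≡.subst (HasDim F (space 𝓗 j) ∘ suc) j≡1+i (dim 𝓗 j)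

        common-drop : common j ≤ suc (suc (common i))
        common-drop = codimension-arithmetic (suc (toℕ i)) (dim-⊓-bound
          {U = space 𝓕 i} {U′ = space 𝓖 i} {V = space 𝓕 j} {V′ = space 𝓖 j} F⊆ G⊆
          (dim 𝓕 i) (dim 𝓖 i) (dim-suc 𝓕) (dim-suc 𝓖) (common-dim j) (common-dim i))

      -- The full space acts as the next member of both flags, at distance 0 from itself, so the
      -- codimension bound applies once more.
      distance-last : ∀ i → suc (toℕ i) ≡ m → distance i ≤ 1
      distance-last i 1+i≡m = ℕ.m≤n+o⇒m∸n≤o (suc (toℕ i)) (common i) (ℕ.≤-pred (ℕ.≤-trans
        (codimension-arithmetic (suc (toℕ i)) (dim-⊓-bound
          {U = space 𝓕 i} {U′ = space 𝓖 i} {V = full (suc m)} {V′ = full (suc m)}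
          (⊆-full {U = space 𝓕 i}) (⊆-full {U = space 𝓖 i}) (dim 𝓕 i) (dim 𝓖 i)
          full-dim′ full-dim′
          (HasDim-resp {U = full (suc m)} {V = _⊓_ F (full (suc m)) (full (suc m))}
            (λ v∈ → v∈ , v∈) proj₁ full-dim′)
          (common-dim i)))
        (ℕ.≤-reflexive (≡.cong suc (ℕ.+-comm 1 (common i))))))
        where
        full-dim′ : HasDim F (full (suc m)) (suc (suc (toℕ i)))
        full-dim′ = ≡.subst (HasDim F (full (suc m)) ∘ suc) (≡.sym 1+i≡m) (full-dim (suc m))

      distanceVector-isPath : IsPath 0 d
      distanceVector-isPath = isPath-tabulated d distance lookup-distance
        distance-first distance-next distance-last (λ _ → z≤n)

    -- Paths are distance vectors

    module _ {m : ℕ} {d : Vec ℤ m} (path : IsPath 0 d) where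

      -- The lower end i - hᵢ of the window, where i is the dimension `suc (toℕ i)`; it becomes the
      -- dimension of the intersection.
      core : Fin m → ℕ
      core i = suc (toℕ i) ∸ height d i

      height≤ : ∀ i → height d i ≤ suc (toℕ i)
      height≤ i = ℕ.≤-trans (proj₂ (height-from-start path i)) (ℕ.≤-reflexive (ℕ.+-identityʳ _))

      core+height : ∀ i → core i + height d i ≡ suc (toℕ i)
      core+height i = ℕ.m∸n+n≡m (height≤ i)

      -- The upper end i + hᵢ of the window is `core i` plus an even length, the form that
      -- `count-window` requires.
      core+2height : ∀ i → core i + height d i * 2 ≡ suc (toℕ i) + height d i
      core+2height i = begin
        core i + height d i * 2            ≡⟨ ≡.cong (core i +_) (ℕ.*-comm (height d i) 2) ⟩
        core i + (height d i + (height d i + 0)) ≡⟨ ≡.cong (λ h → core i + (height d i + h)) (ℕ.+-identityʳ _) ⟩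
        core i + (height d i + height d i) ≡⟨ ℕ.+-assoc (core i) _ _ ⟨
        core i + height d i + height d i   ≡⟨ ≡.cong (_+ height d i) (core+height i) ⟩
        suc (toℕ i) + height d i           ∎
        where open ≡.≡-Reasoning

      core-mono : ∀ {i j} → i Fin.< j → core i ≤ core j
      core-mono {i} {j} i<j = ℕ.m+n≤o⇒m≤o∸n (core i) (ℕ.+-cancelʳ-≤ (height d i) _ _ (begin
        core i + height d j + height d i   ≡⟨ ℕ.+-assoc (core i) _ _ ⟩
        core i + (height d j + height d i) ≡⟨ ≡.cong (core i +_) (ℕ.+-comm (height d j) _) ⟩
        core i + (height d i + height d j) ≡⟨ ℕ.+-assoc (core i) _ _ ⟨
        core i + height d i + height d j   ≡⟨ ≡.cong (_+ height d j) (core+height i) ⟩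
        suc (toℕ i) + height d j           ≤⟨ s≤s (proj₂ (height-lipschitz path i<j)) ⟩
        suc (toℕ j) + height d i           ∎))
        where open ℕ.≤-Reasoning

      coordinateFlag : Bool → FullFlag F (suc m)
      coordinateFlag p = record
        { space  = space
        -- A reverse inclusion would bound the larger dimension by the smaller one.
        ; strict = λ {i} {j} i<j → space-mono i<j , λ space-j⊆ → ℕ.<⇒≱ (s≤s i<j)
            (dim-mono {U = space j} {V = space i} (space-dim j) (space-dim i) space-j⊆)
        ; dim    = space-dim
        }
        where
        space : Fin m → Subspace F (suc m)
        space i = coordinate (window p (core i) (core i + height d i * 2)) (suc m)

        space-dim : ∀ i → HasDim F (space i) (suc (toℕ i))
        space-dim i = ≡.subst (HasDim F (space i)) (core+height i) (coordinate-dim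
          (count-window p (core i) (height d i) (ℕ.≤-trans (ℕ.≤-reflexive (core+2height i))
            (s≤s (height-to-end path i)))))

        space-mono : ∀ {i j} → i Fin.< j → member (space i) ⊆ member (space j)
        space-mono {i} {j} i<j = coordinate-mono (window-mono p (core-mono i<j)
          (≡.subst₂ _≤_ (≡.sym (core+2height i)) (≡.sym (core+2height j))
            (s≤s (proj₁ (height-lipschitz path i<j)))))

      path-isDistanceVector : IsDistanceVector F (coordinateFlag false) (coordinateFlag true) d
      path-isDistanceVector i =
        suc (toℕ i) , core i , dim (coordinateFlag false) i , dim (coordinateFlag true) i ,
        HasDim-resp {U = coordinate (_<ᵇ core i) (suc m)} {V = _⊓_ F (A false) (A true)}
          (λ v∈ → coordinate-mono (window-false⇒≥ false (core i) (core i + height d i * 2)) v∈ ,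
                  coordinate-mono (window-false⇒≥ true (core i) (core i + height d i * 2)) v∈)
          -- A vector in both spaces vanishes at every j beyond the core, as one of the two windows
          -- omits j.
          (λ (lift v∈₀ , lift v∈₁) → lift λ j j≮ → [ v∈₀ j , v∈₁ j ]′
            (outside-window (core i) (core i + height d i * 2) (toℕ j) j≮))
          (coordinate-dim (count-initial (ℕ.≤-trans (ℕ.m∸n≤m _ (height d i)) (s≤s (ℕ.<⇒≤ (toℕ<n i)))))) ,
        distance≡
        where
        open FullFlag using (dim; space)

        A : Bool → Subspace F (suc m)
        A p = space (coordinateFlag p) i

        distance≡ : lookup d i ≡ pos (suc (toℕ i)) ℤ.- pos (core i)
        distance≡ = begin
          lookup d i                            ≡⟨ lookup-isPath path i ⟩
          pos (height d i)                      ≡⟨ ≡.cong pos (ℕ.m∸[m∸n]≡n (height≤ i)) ⟨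
          pos (suc (toℕ i) ∸ core i)            ≡⟨ ℤ.⊖-≥ (ℕ.m∸n≤m _ (height d i)) ⟨
          suc (toℕ i) ℤ.⊖ core i                ≡⟨ ℤ.m-n≡m⊖n (suc (toℕ i)) (core i) ⟨
          pos (suc (toℕ i)) ℤ.- pos (core i)    ∎
          where open ≡.≡-Reasoning

-- The number of distance vectors

corollary4p4 : ∀ {c ℓ₁ ℓ₂ : Level} (q : ℕ) → IsPrimePower q →
    (F : HeytingField c ℓ₁ ℓ₂) → HasOrder F q →
    (n : ℕ) → 2 ≤ n → HasCardinality (DistanceVectors F n) (motzkin n)
corollary4p4 q q-primePower F order (suc m) _ =
  -- With n = m + 1, the m entries are the inner heights of a path of length n from height 0 to
  -- height 0.
  paths m 0 , paths-unique m 0 , ≡.trans (length-paths m 0) (pathCount≡motzkin (suc m)) ,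
  λ d → mk⇔
    (λ d∈ → let path = paths-sound m 0 d∈ in
      coordinateFlag 1<q order path false , coordinateFlag 1<q order path true ,
      path-isDistanceVector 1<q order path)
    (λ (𝓕 , 𝓖 , isDistance) → paths-complete (distanceVector-isPath 1<q order 𝓕 𝓖 isDistance))
  where
  open LinearAlgebra F
  1<q = primePower>1 q-primePower
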